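{- Let $A=\{1\text{ - }32\text{ - }4,\ 1\text{ - }42\text{ - }3,\ 2\text{ - }31\text{ - }4,\ 2\text{ - }41\text{ - }3\}$ and $B=\{1\text{ - }3\text{ - }2\text{ - }4,\ 1\text{ - }4\text{ - }2\text{ - }3,\ 2\text{ - }3\text{ - }1\text{ - }4,\ 2\text{ - }4\text{ - }1\text{ - }3\}$ be sets of (dashed) patterns. Then $\mathrm{Av}(A)=\mathrm{Av}(B)$; that is, a permutation avoids all patterns in $A$ if and only if it avoids all patterns in $B$.
   Context: A permutation of length $n$ is written in one-line notation $\sigma_1\sigma_2\cdots\sigma_n$, a rearrangement of $1,\dots,n$. A (dashed, generalized) pattern is a permutation $\pi_1\cdots\pi_k$ in which some or all of the adjacent elements may be separated by dashes. A subsequence $\sigma_{i_1}\sigma_{i_2}\cdots\sigma_{i_k}$ (with $i_1<i_2<\cdots<i_k$) of a permutation $\sigma$ is an occurrence of the pattern if (i) its elements have the same relative order as $\pi_1,\dots,\pi_k$ (i.e. $\sigma_{i_s}<\sigma_{i_t}$ if and only if $\pi_s<\pi_t$), and (ii) whenever there is no dash between the $j$th and $(j+1)$th elements of the pattern, the $j$th and $(j+1)$th elements of the subsequence occur consecutively in $\sigma$ (i.e. $i_{j+1}=i_j+1$). Where there is a dash, the corresponding elements may or may not be consecutive in $\sigma$. A permutation avoids a pattern if it contains no occurrence of it, and avoids a set of patterns if it contains no occurrence of any pattern in the set. For a set $S$ of patterns, $\mathrm{Av}(S)$ denotes the set of all permutations (of any length) that avoid $S$. -}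

module Defs where

open import Data.Fin.Base using (Fin; suc; inject₁; toℕ; _<_)
open import Data.Fin.Patterns using (0F; 1F; 2F; 3F)
open import Data.Fin.Permutation using (Permutation′; permutation; _⟨$⟩ʳ_)
open import Data.Fin.Properties using (all?; _≟_)
open import Data.List.Base using (List; []; _∷_)
open import Data.List.Membership.Propositional using (_∈_)
open import Data.Nat.Base as ℕ using (ℕ)
open import Data.Product.Base using (∃; _,_)
open import Data.Vec.Base using (Vec; []; _∷_; lookup)
open import Function.Bundles using (_⇔_)
open import Level using (0ℓ)
open import Relation.Binary.PropositionalEquality.Core using (_≡_)
open import Relation.Nullary.Decidable using (True; toWitness)
open import Relation.Nullary.Negation using (¬_)
open import Relation.Unary using (Pred)

-- Positions and values are numbered from 0, so the one-line notation
-- 1423 is written 0F ∷ 3F ∷ 1F ∷ 2F ∷ [].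

-- The inverse word is supplied explicitly and checked by computation.
oneLine : ∀ {n} (word inverse : Vec (Fin n) n)
          {_ : True (all? λ i → lookup word (lookup inverse i) ≟ i)}
          {_ : True (all? λ i → lookup inverse (lookup word i) ≟ i)} →
          Permutation′ n
oneLine word inverse {invˡ} {invʳ} =
  permutation (lookup word) (lookup inverse) (toWitness invˡ) (toWitness invʳ)

data Gap : Set where
  dash noDash : Gap

-- gaps j is the gap between the elements at positions j and j + 1.
record Pattern : Set where
  constructor pattern′
  field
    {#gaps} : ℕ
    perm    : Permutation′ (ℕ.suc #gaps)
    gaps    : Vec Gap #gaps

record Occurrence (p : Pattern) {n : ℕ} (σ : Permutation′ n) : Set where
  open Pattern p
  field
    index       : Fin (ℕ.suc #gaps) → Fin n
    increasing  : ∀ s t → s < t → index s < index t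
    sameOrder   : ∀ s t → (σ ⟨$⟩ʳ index s < σ ⟨$⟩ʳ index t) ⇔
                          (perm ⟨$⟩ʳ s < perm ⟨$⟩ʳ t)
    consecutive : ∀ j → lookup gaps j ≡ noDash →
                  toℕ (index (suc j)) ≡ ℕ.suc (toℕ (index (inject₁ j)))

Av : Pred Pattern 0ℓ → Pred (∃ Permutation′) 0ℓ
Av S (n , σ) = ∀ p → S p → ¬ Occurrence p σ

1324ₚ 1423ₚ 2314ₚ 2413ₚ : Permutation′ 4
1324ₚ = oneLine (0F ∷ 2F ∷ 1F ∷ 3F ∷ []) (0F ∷ 2F ∷ 1F ∷ 3F ∷ [])
1423ₚ = oneLine (0F ∷ 3F ∷ 1F ∷ 2F ∷ []) (0F ∷ 2F ∷ 3F ∷ 1F ∷ [])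
2314ₚ = oneLine (1F ∷ 2F ∷ 0F ∷ 3F ∷ []) (2F ∷ 0F ∷ 1F ∷ 3F ∷ [])
2413ₚ = oneLine (1F ∷ 3F ∷ 0F ∷ 2F ∷ []) (2F ∷ 0F ∷ 3F ∷ 1F ∷ [])

1-32-4 1-42-3 2-31-4 2-41-3 : Pattern
1-32-4 = pattern′ 1324ₚ (dash ∷ noDash ∷ dash ∷ [])
1-42-3 = pattern′ 1423ₚ (dash ∷ noDash ∷ dash ∷ [])
2-31-4 = pattern′ 2314ₚ (dash ∷ noDash ∷ dash ∷ [])
2-41-3 = pattern′ 2413ₚ (dash ∷ noDash ∷ dash ∷ [])

1-3-2-4 1-4-2-3 2-3-1-4 2-4-1-3 : Pattern
1-3-2-4 = pattern′ 1324ₚ (dash ∷ dash ∷ dash ∷ [])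
1-4-2-3 = pattern′ 1423ₚ (dash ∷ dash ∷ dash ∷ [])
2-3-1-4 = pattern′ 2314ₚ (dash ∷ dash ∷ dash ∷ [])
2-4-1-3 = pattern′ 2413ₚ (dash ∷ dash ∷ dash ∷ [])

A B : Pred Pattern 0ℓ
A = _∈ (1-32-4 ∷ 1-42-3 ∷ 2-31-4 ∷ 2-41-3 ∷ [])
B = _∈ (1-3-2-4 ∷ 1-4-2-3 ∷ 2-3-1-4 ∷ 2-4-1-3 ∷ [])

{-# OPTIONS --safe #-}
-- An occurrence of some pattern of B is the same thing as four positions
-- i < j < k < l whose values at i and k lie below those at j and l.  Call a
-- position high if its value exceeds both those at i and k.  Then j is high
-- and k is not, so some high position a with j ≤ a < k is followed by a position
-- a + 1 that is not; i, a, a + 1, l alternate as well, and give an occurrence of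
-- a pattern of A.
module Submission where

open import Defs
open import Data.Fin.Base using (Fin; zero; suc; inject₁; toℕ; _<_; _≤_)
open import Data.Fin.Patterns using (0F; 1F; 2F; 3F)
open import Data.Fin.Permutation
  using (Permutation′; _⟨$⟩ʳ_; _⟨$⟩ˡ_; inverseˡ)
open import Data.Fin.Properties
  using (_<?_; <-cmp; <-trans; <-irrefl; <-asym)
open import Data.List.Relation.Unary.Any using (here; there)
open import Data.Nat.Base as ℕ using (ℕ; z≤n; s≤s; s≤s⁻¹; z<s; s<s; s<s⁻¹)
import Data.Nat.Properties as ℕ
open import Data.Product.Base using (∃; ∃₂; _×_; _,_; -,_)
open import Data.Sum.Base using (_⊎_; inj₁; inj₂)
open import Data.Vec.Base using (Vec; []; _∷_; lookup; replicate)
open import Data.Vec.Properties using (lookup-replicate)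
open import Function.Base using (_∘_)
open import Function.Bundles using (mk⇔; module Equivalence; module Injection)
open import Function.Definitions using (Injective)
open import Function.Properties.Inverse using (↔⇒↣)
open import Relation.Binary.Definitions using (tri<; tri≈; tri>)
open import Relation.Binary.PropositionalEquality
  using (_≡_; _≢_; refl; sym; trans; cong; subst₂)
open import Relation.Nullary.Decidable using (yes; no; True; toWitness; _×-dec_)
open import Relation.Nullary.Negation using (¬_; contradiction)
open import Relation.Unary using (Pred; Decidable; _≐_)

private variable
  m n : ℕ

⟨$⟩ʳ-injective : (σ : Permutation′ n) → Injective _≡_ _≡_ (σ ⟨$⟩ʳ_)
⟨$⟩ʳ-injective σ = Injection.injective (↔⇒↣ σ)

steps⇒strictMono : (f : Fin (ℕ.suc m) → Fin n) →
                   (∀ i → f (inject₁ i) < f (suc i)) →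
                   ∀ i j → i < j → f i < f j
steps⇒strictMono {m = ℕ.suc m} f step zero (suc zero) _ = step zero
steps⇒strictMono {m = ℕ.suc m} f step zero (suc (suc j)) _ =
  <-trans (step zero) (steps⇒strictMono (f ∘ suc) (step ∘ suc) zero (suc j) z<s)
steps⇒strictMono {m = ℕ.suc m} f step (suc i) (suc j) i<j =
  steps⇒strictMono (f ∘ suc) (step ∘ suc) i j (s<s⁻¹ i<j)

-- A discrete intermediate value argument: walking up from `i`, the first failure of `P` comes no
-- later than `j`, and `a` is the position just before it.
lastBefore : ∀ {p} {P : Pred (Fin n) p} → Decidable P →
             ∀ {i j} → i ≤ j → P i → ¬ P j →
             ∃₂ λ a b → i ≤ a × b ≤ j × toℕ b ≡ ℕ.suc (toℕ a) × P a × ¬ P b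
lastBefore P? {zero} {zero} _ Pi ¬Pj = contradiction Pi ¬Pj
lastBefore {n = ℕ.suc (ℕ.suc n)} P? {zero} {suc j} _ Pi ¬Pj with P? (suc zero)
... | no ¬P1 = zero , suc zero , z≤n , s≤s z≤n , refl , Pi , ¬P1
... | yes P1 =
  let a , b , _ , b≤j , b≡1+a , Pa , ¬Pb = lastBefore (P? ∘ suc) {zero} z≤n P1 ¬Pj
  in suc a , suc b , z≤n , s≤s b≤j , cong ℕ.suc b≡1+a , Pa , ¬Pb
lastBefore P? {suc i} {suc j} i≤j Pi ¬Pj =
  let a , b , i≤a , b≤j , b≡1+a , Pa , ¬Pb = lastBefore (P? ∘ suc) (s≤s⁻¹ i≤j) Pi ¬Pj
  in suc a , suc b , s≤s i≤a , s≤s b≤j , cong ℕ.suc b≡1+a , Pa , ¬Pb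

-- The comparisons of `f i` with `f k` and of `f j` with `f l` are left open: settling them is what
-- tells the four patterns apart.
record Alternates (f : Fin m → Fin n) (i j k l : Fin m) : Set where
  field
    i<j   : i < j
    j<k   : j < k
    k<l   : k < l
    fi<fj : f i < f j
    fk<fj : f k < f j
    fi<fl : f i < f l
    fk<fl : f k < f l

tighten : {f : Fin m → Fin n} {i j k l : Fin m} → Alternates f i j k l →
          ∃₂ λ a b → toℕ b ≡ ℕ.suc (toℕ a) × Alternates f i a b l
tighten {m} {f = f} {i} {j} {k} {l} alt =
  let a , b , j≤a , b≤k , b≡1+a , (fi<fa , fk<fa) , b-low =
        lastBefore (λ x → (f i <? f x) ×-dec (f k <? f x))
                   (ℕ.<⇒≤ j<k) (fi<fj , fk<fj) (λ (_ , fk<fk) → <-irrefl refl fk<fk)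
  in a , b , b≡1+a , record
    { i<j = ℕ.<-≤-trans i<j j≤a
    ; j<k = ℕ.≤-reflexive (sym b≡1+a)
    ; k<l = ℕ.≤-<-trans b≤k k<l
    ; fi<fj = fi<fa
    ; fk<fj = low<high b-low fi<fa fk<fa
    ; fi<fl = fi<fl
    ; fk<fl = low<high b-low fi<fl fk<fl
    }
  where
  open Alternates alt
  -- A position that is not high has value at most `f i` or at most `f k`, and `f x` exceeds both.
  -- It is applied with `x` equal to `a` and to `l`.
  low<high : {b x : Fin m} → ¬ (f i < f b × f k < f b) →
             f i < f x → f k < f x → f b < f x
  low<high {b} b-low fi<fx fk<fx with f i <? f b
  ... | no  fi≮fb = ℕ.≤-<-trans (ℕ.≮⇒≥ fi≮fb) fi<fx
  ... | yes fi<fb = ℕ.≤-<-trans (ℕ.≮⇒≥ λ fk<fb → b-low (fi<fb , fk<fb)) fk<fx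

-- Only `consecutive` depends on the gaps, and it is vacuous when all of them are dashes. For
-- `m = 3` the vector `replicate m dash` computes to the gaps of the patterns in `B`.
dashAll : {π : Permutation′ (ℕ.suc m)} {gaps : Vec Gap m} {σ : Permutation′ n} →
          Occurrence (pattern′ π gaps) σ →
          Occurrence (pattern′ π (replicate m dash)) σ
dashAll occ = record
  { index = index
  ; increasing = increasing
  ; sameOrder = sameOrder
  ; consecutive = λ j eq →
      contradiction (trans (sym (lookup-replicate j dash)) eq) λ ()
  }
  where open Occurrence occ

-- π ⟨$⟩ˡ v is the place in the pattern of its (v + 1)-st smallest entry, so
-- comparing values at consecutive v suffices for the whole relative order.
occurrence : (π : Permutation′ (ℕ.suc m)) {gaps : Vec Gap m} (σ : Permutation′ n)
             (index : Fin (ℕ.suc m) → Fin n) →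
             (∀ j → index (inject₁ j) < index (suc j)) →
             (∀ j → σ ⟨$⟩ʳ index (π ⟨$⟩ˡ inject₁ j) < σ ⟨$⟩ʳ index (π ⟨$⟩ˡ suc j)) →
             (∀ j → lookup gaps j ≡ noDash →
                    toℕ (index (suc j)) ≡ ℕ.suc (toℕ (index (inject₁ j)))) →
             Occurrence (pattern′ π gaps) σ
occurrence π σ index positions values consecutive = record
  { index = index
  ; increasing = steps⇒strictMono index positions
  ; sameOrder = λ s t → mk⇔ (reflects s t) (preserves s t)
  ; consecutive = consecutive
  }
  where
  preserves : ∀ s t → π ⟨$⟩ʳ s < π ⟨$⟩ʳ t → σ ⟨$⟩ʳ index s < σ ⟨$⟩ʳ index t
  preserves s t πs<πt =
    subst₂ (λ x y → σ ⟨$⟩ʳ index x < σ ⟨$⟩ʳ index y) (inverseˡ π) (inverseˡ π)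
      (steps⇒strictMono (λ v → σ ⟨$⟩ʳ index (π ⟨$⟩ˡ v)) values _ _ πs<πt)

  -- By trichotomy: equal pattern entries force `s ≡ t`, and a reversed pair contradicts
  -- `preserves`.
  reflects : ∀ s t → σ ⟨$⟩ʳ index s < σ ⟨$⟩ʳ index t → π ⟨$⟩ʳ s < π ⟨$⟩ʳ t
  reflects s t lt with <-cmp (π ⟨$⟩ʳ s) (π ⟨$⟩ʳ t)
  ... | tri< πs<πt _ _ = πs<πt
  ... | tri≈ _ πs≡πt _ =
    contradiction lt (<-irrefl (cong (λ x → σ ⟨$⟩ʳ index x) (⟨$⟩ʳ-injective π πs≡πt)))
  ... | tri> _ _ πt<πs = contradiction lt (<-asym (preserves t s πt<πs))

-- The four `True` arguments are the comparisons shared by 1324, 1423, 2314 and 2413; for a concrete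
-- `π` they are settled by computation.
occurrence⇒alternates :
  (π : Permutation′ 4) {gaps : Vec Gap 3} {σ : Permutation′ n}
  {_ : True (π ⟨$⟩ʳ 0F <? π ⟨$⟩ʳ 1F)} {_ : True (π ⟨$⟩ʳ 2F <? π ⟨$⟩ʳ 1F)}
  {_ : True (π ⟨$⟩ʳ 0F <? π ⟨$⟩ʳ 3F)} {_ : True (π ⟨$⟩ʳ 2F <? π ⟨$⟩ʳ 3F)} →
  (occ : Occurrence (pattern′ π gaps) σ) → let open Occurrence occ in
  Alternates (σ ⟨$⟩ʳ_) (index 0F) (index 1F) (index 2F) (index 3F)
occurrence⇒alternates π {_} {_} {p} {q} {r} {s} occ = record
  { i<j = increasing 0F 1F z<s
  ; j<k = increasing 1F 2F (s<s z<s)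
  ; k<l = increasing 2F 3F (s<s (s<s z<s))
  ; fi<fj = from (sameOrder 0F 1F) (toWitness p)
  ; fk<fj = from (sameOrder 2F 1F) (toWitness q)
  ; fi<fl = from (sameOrder 0F 3F) (toWitness r)
  ; fk<fl = from (sameOrder 2F 3F) (toWitness s)
  }
  where
  open Occurrence occ
  open Equivalence using (from)

B⇒alternates : {p : Pattern} {σ : Permutation′ n} → B p → Occurrence p σ →
               ∃₂ λ i j → ∃₂ λ k l → Alternates (σ ⟨$⟩ʳ_) i j k l
B⇒alternates (here refl) occ = -, -, -, -, occurrence⇒alternates 1324ₚ occ
B⇒alternates (there (here refl)) occ = -, -, -, -, occurrence⇒alternates 1423ₚ occ
B⇒alternates (there (there (here refl))) occ = -, -, -, -, occurrence⇒alternates 2314ₚ occ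
B⇒alternates (there (there (there (here refl)))) occ =
  -, -, -, -, occurrence⇒alternates 2413ₚ occ

<⊎> : (σ : Permutation′ n) {i j : Fin n} → i ≢ j →
      σ ⟨$⟩ʳ i < σ ⟨$⟩ʳ j ⊎ σ ⟨$⟩ʳ j < σ ⟨$⟩ʳ i
<⊎> σ {i} {j} i≢j with <-cmp (σ ⟨$⟩ʳ i) (σ ⟨$⟩ʳ j)
... | tri< lt _ _ = inj₁ lt
... | tri≈ _ eq _ = contradiction (⟨$⟩ʳ-injective σ eq) i≢j
... | tri> _ _ gt = inj₂ gt

alternates⇒A : {σ : Permutation′ n} {i j k l : Fin n} →
               toℕ k ≡ ℕ.suc (toℕ j) → Alternates (σ ⟨$⟩ʳ_) i j k l →
               ∃ λ p → A p × Occurrence p σ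
alternates⇒A {n} {σ} {i} {j} {k} {l} k≡1+j alt = byOrder
  (<⊎> σ (λ i≡k → <-irrefl i≡k (<-trans i<j j<k)))
  (<⊎> σ (λ j≡l → <-irrefl j≡l (<-trans j<k k<l)))
  where
  open Alternates alt

  index : Fin 4 → Fin n
  index = lookup (i ∷ j ∷ k ∷ l ∷ [])

  at : (π : Permutation′ 4) →
       (∀ v → σ ⟨$⟩ʳ index (π ⟨$⟩ˡ inject₁ v) < σ ⟨$⟩ʳ index (π ⟨$⟩ˡ suc v)) →
       Occurrence (pattern′ π (dash ∷ noDash ∷ dash ∷ [])) σ
  at π values = occurrence π σ index
    (λ { 0F → i<j ; 1F → j<k ; 2F → k<l }) values
    (λ { 0F () ; 1F _ → k≡1+j ; 2F () })

  byOrder : σ ⟨$⟩ʳ i < σ ⟨$⟩ʳ k ⊎ σ ⟨$⟩ʳ k < σ ⟨$⟩ʳ i →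
            σ ⟨$⟩ʳ j < σ ⟨$⟩ʳ l ⊎ σ ⟨$⟩ʳ l < σ ⟨$⟩ʳ j →
            ∃ λ p → A p × Occurrence p σ
  -- Each case lists the comparisons along increasing values; the middle one goes from the larger of
  -- the values at `i` and `k` to the smaller of those at `j` and `l`.
  byOrder (inj₁ ik) (inj₁ jl) =
    -, here refl , at 1324ₚ λ { 0F → ik ; 1F → fk<fj ; 2F → jl }
  byOrder (inj₁ ik) (inj₂ lj) =
    -, there (here refl) , at 1423ₚ λ { 0F → ik ; 1F → fk<fl ; 2F → lj }
  byOrder (inj₂ ki) (inj₁ jl) =
    -, there (there (here refl)) , at 2314ₚ λ { 0F → ki ; 1F → fi<fj ; 2F → jl }
  byOrder (inj₂ ki) (inj₂ lj) =
    -, there (there (there (here refl))) , at 2413ₚ λ { 0F → ki ; 1F → fi<fl ; 2F → lj }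

A⇒B : {p : Pattern} {σ : Permutation′ n} → A p → Occurrence p σ →
      ∃ λ q → B q × Occurrence q σ
A⇒B (here refl) occ = -, here refl , dashAll occ
A⇒B (there (here refl)) occ = -, there (here refl) , dashAll occ
A⇒B (there (there (here refl))) occ = -, there (there (here refl)) , dashAll occ
A⇒B (there (there (there (here refl)))) occ =
  -, there (there (there (here refl))) , dashAll occ

B⇒A : {p : Pattern} {σ : Permutation′ n} → B p → Occurrence p σ →
      ∃ λ q → A q × Occurrence q σ
B⇒A p∈B occ =
  let _ , _ , _ , _ , alt = B⇒alternates p∈B occ
      _ , _ , b≡1+a , alt′ = tighten alt
  in alternates⇒A b≡1+a alt′

proposition1 : Av A ≐ Av B
proposition1 =
  -- Avoidance reverses direction: avoiding `A` implies avoiding `B` because occurrences pass from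
  -- `B` to `A`.
  (λ avA p p∈B occ → let q , q∈A , occ′ = B⇒A p∈B occ in avA q q∈A occ′) ,
  (λ avB p p∈A occ → let q , q∈B , occ′ = A⇒B p∈A occ in avB q q∈B occ′)
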